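{- Let $H=(V,E)$ be a hypergraph with $n=|V|$ and let $e\in E$. For $1\leq i\leq n$ let $$a_i=\sum_{\substack{F\subseteq E\\ k(F)=i}}(-1)^{|F|},$$ and for $1\leq i,j\leq n$ let $$b_e^{i,j}=\sum_{F\in\mathcal{B}_e^{i,j}}(-1)^{|F|},\qquad \mathcal{B}_e^{i,j}=\{F\subseteq E\mid e\in F,\ k(F)=i,\ k(F\setminus\{e\})=j\}.$$ Then for every $i=1,\dots,n$, $$a_i=\sum_{i<j\leq n}b_e^{i,j}-\sum_{1\leq j<i}b_e^{j,i}.$$
   Context: A hypergraph is a pair $H=(V,E)$ where $V$ is a finite non-empty set (vertices) and $E$ is a set of subsets of $V$ (edges), each of cardinality at least $2$. Two distinct vertices are neighbours if some edge contains both; connectedness of vertices is the equivalence relation generated by being neighbours, and the connected components are given by its equivalence classes. For $F\subseteq E$, $k(F)$ denotes the number of connected components of the spanning subgraph $(V,F)$ (isolated vertices count as components). The numbers $a_i$ are the coefficients of the chromatic polynomial of $H$, $\chi_H(\lambda)=\sum_{i=1}^n a_i\lambda^i$. -}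

module Defs where

open import Data.Fin using (Fin; punchIn; punchOut)
open import Data.Fin.Properties using (punchOut-punchIn; punchOut-cong;
  punchOut-injective; punchInᵢ≢i; any?) renaming (_≟_ to _≟ᶠ_)
open import Data.Fin.Subset using (Subset; _∈_; ∣_∣; _-_; inside; outside)
open import Data.Fin.Subset.Properties using (_∈?_)
open import Data.Integer using (ℤ; 0ℤ; -1ℤ; _^_) renaming (_+_ to _+ᶻ_)
open import Data.List using (List; []; _∷_; _++_; map; foldr; filter; applyUpTo; allFin; cartesianProduct)
open import Data.List.Membership.Propositional using () renaming (_∈_ to _∈ˡ_)
open import Data.List.Membership.Propositional.Properties
  using (∈-filter⁺; ∈-filter⁻; ∈-cartesianProduct⁺; ∈-allFin)
open import Data.List.Relation.Unary.Any using (here; there)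
open import Data.Nat using (ℕ; zero; suc; _≤_; NonZero; _≟_)
open import Data.Product using (Σ; _×_; _,_; proj₁; proj₂; ∃-syntax; uncurry)
open import Data.Vec using () renaming ([] to []ᵛ; _∷_ to _∷ᵛ_)
open import Function using (_∘_; Inverse; Injective)
open import Level using (0ℓ)
open import Relation.Binary using (Rel; Decidable)
import Relation.Binary.Construct.Closure.Equivalence as Eq
open import Relation.Binary.Construct.Closure.Equivalence using (EqClosure)
import Relation.Binary.Construct.On as On
open import Relation.Binary.PropositionalEquality
  using (_≡_; _≢_; refl; sym; trans; cong; isEquivalence; setoid)
open import Relation.Nullary using (Dec; yes; no; contradiction; ¬?; _×-dec_)
open import Relation.Unary using () renaming (Decidable to Decidable₁)

------------------------------------------------------------------------
-- Counting equivalence classes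

-- The quotient of Fin n by the equivalence relation generated by R is in
-- bijection with Fin k.
HasClasses : ∀ {n} → Rel (Fin n) 0ℓ → ℕ → Set
HasClasses R k = Inverse (Eq.setoid R) (setoid (Fin k))

private
  Listed : ∀ {n} → List (Fin n × Fin n) → Rel (Fin n) 0ℓ
  Listed L x y = (x , y) ∈ˡ L

  -- Adding one pair either changes nothing or merges two classes.
  classesListed : ∀ {n} (L : List (Fin n × Fin n)) → Σ ℕ (HasClasses (Listed L))
  classesListed {n} [] = n , record
    { to        = λ x → x
    ; from      = λ x → x
    ; to-cong   = Eq.fold isEquivalence (λ ())
    ; from-cong = λ { refl → Eq.reflexive _ }
    ; inverse   = Eq.fold isEquivalence (λ ()) , λ { refl → Eq.reflexive _ }
    }
  classesListed {n} ((a , b) ∷ L) with classesListed L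
  ... | k , I = go k I
    where
    R  = Listed L
    R′ = Listed ((a , b) ∷ L)

    lift : ∀ {x y} → EqClosure R x y → EqClosure R′ x y
    lift = Eq.map there

    pair : EqClosure R′ a b
    pair = Eq.return (here refl)

    -- A surjection onto Fin k whose kernel is the generated equivalence.
    make : ∀ {k} (to : Fin n → Fin k) (from : Fin k → Fin n) →
           (∀ {x y} → R′ x y → to x ≡ to y) →
           (∀ {x y} → to x ≡ to y → EqClosure R′ x y) →
           (∀ c → to (from c) ≡ c) → HasClasses R′ k
    make to from resp eff sect = record
      { to        = to
      ; from      = from
      ; to-cong   = to-cong
      ; from-cong = λ { refl → Eq.reflexive _ }
      ; inverse   = (λ p → trans (to-cong p) (sect _)) , λ { refl → eff (sect _) }
      }
      where
      to-cong : ∀ {x y} → EqClosure R′ x y → to x ≡ to y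
      to-cong = Eq.fold (On.isEquivalence to isEquivalence) resp

    eff : ∀ {k} (I : HasClasses R k) {x y} → Inverse.to I x ≡ Inverse.to I y → EqClosure R x y
    eff I {x} {y} p = Eq.transitive R (Eq.symmetric R (strictlyInverseʳ x))
                        (Eq.transitive R (from-cong p) (strictlyInverseʳ y))
      where open Inverse I

    go : ∀ k → HasClasses R k → Σ ℕ (HasClasses R′)
    go zero    I with () ← Inverse.to I a
    go (suc k) I with Inverse.to I b ≟ᶠ Inverse.to I a
    ... | yes cb≡ca = suc k , make to from
      (λ { (here refl) → sym cb≡ca ; (there p) → to-cong (Eq.return p) })
      (lift ∘ eff I) strictlyInverseˡ
      where open Inverse I
    ... | no cb≢ca = k , make to′ (from ∘ punchIn cb) resp eff′ sect
      where
      open Inverse I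
      cb = to b

      redirect : ∀ c → Dec (cb ≡ c) → Fin k
      redirect c (yes _) = punchOut cb≢ca
      redirect c (no q)  = punchOut q

      to′ : Fin n → Fin k
      to′ x = redirect (to x) (cb ≟ᶠ to x)

      resp : ∀ {x y} → R′ x y → to′ x ≡ to′ y
      resp (here refl) with cb ≟ᶠ to a | cb ≟ᶠ to b
      ... | yes p | _     = contradiction p cb≢ca
      ... | no _  | yes _ = punchOut-cong cb refl
      ... | no _  | no q  = contradiction refl q
      resp (there p) = cong (λ c → redirect c (cb ≟ᶠ c)) (to-cong (Eq.return p))

      eff′ : ∀ {x y} → to′ x ≡ to′ y → EqClosure R′ x y
      eff′ {x} {y} p with cb ≟ᶠ to x | cb ≟ᶠ to y
      ... | yes u | yes v = lift (eff I (trans (sym u) v))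
      ... | yes u | no v  = Eq.transitive R′ (Eq.symmetric R′ (lift (eff I u)))
        (Eq.transitive R′ (Eq.symmetric R′ pair) (lift (eff I (punchOut-injective cb≢ca v p))))
      ... | no u  | yes v = Eq.transitive R′ (lift (eff I (punchOut-injective u cb≢ca p)))
        (Eq.transitive R′ pair (lift (eff I v)))
      ... | no u  | no v  = lift (eff I (punchOut-injective u v p))

      sect : ∀ c → to′ (from (punchIn cb c)) ≡ c
      sect c with to (from (punchIn cb c)) | strictlyInverseˡ (punchIn cb c)
      ... | _ | refl with cb ≟ᶠ punchIn cb c
      ...   | yes p = contradiction (sym p) (punchInᵢ≢i cb c)
      ...   | no _  = trans (punchOut-cong cb refl) (punchOut-punchIn cb)

classes : ∀ {n} {R : Rel (Fin n) 0ℓ} → Decidable R → Σ ℕ (HasClasses R)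
classes {n} {R} R? with classesListed (filter (uncurry R?) (cartesianProduct (allFin n) (allFin n)))
... | k , I = k , record
  { to        = to
  ; from      = from
  ; to-cong   = to-cong ∘ Eq.map enlist
  ; from-cong = Eq.map delist ∘ from-cong
  ; inverse   = inverseˡ ∘ Eq.map enlist , Eq.map delist ∘ inverseʳ
  }
  where
  open Inverse I
  pairs = cartesianProduct (allFin n) (allFin n)

  enlist : ∀ {x y} → R x y → Listed (filter (uncurry R?) pairs) x y
  enlist {x} {y} = ∈-filter⁺ (uncurry R?) (∈-cartesianProduct⁺ (∈-allFin x) (∈-allFin y))

  delist : ∀ {x y} → Listed (filter (uncurry R?) pairs) x y → R x y
  delist = proj₂ ∘ ∈-filter⁻ (uncurry R?) {xs = pairs}

------------------------------------------------------------------------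
-- Hypergraphs

-- The vertex set is Fin n.  The edge set is enumerated without repetition by
-- Fin m, so that sets of edges are Subset m.
record Hypergraph : Set where
  field
    n              : ℕ
    nonEmpty       : NonZero n
    m              : ℕ
    edge           : Fin m → Subset n
    edge-injective : Injective _≡_ _≡_ edge
    edge-size      : ∀ e → 2 ≤ ∣ edge e ∣

  Neighbours : Subset m → Rel (Fin n) 0ℓ
  Neighbours F x y = x ≢ y × ∃[ f ] (f ∈ F × x ∈ edge f × y ∈ edge f)

  neighbours? : ∀ F → Decidable (Neighbours F)
  neighbours? F x y =
    ¬? (x ≟ᶠ y) ×-dec any? (λ f → (f ∈? F) ×-dec (x ∈? edge f) ×-dec (y ∈? edge f))

  components : ∀ F → Σ ℕ (HasClasses (Neighbours F))
  components F = classes (neighbours? F)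

  k : Subset m → ℕ
  k F = proj₁ (components F)

------------------------------------------------------------------------
-- Signed sums

∑ : {A : Set} → List A → (A → ℤ) → ℤ
∑ xs f = foldr _+ᶻ_ 0ℤ (map f xs)

[1⋯_] : ℕ → List ℕ
[1⋯ n ] = applyUpTo suc n

-- Every subset of Fin m, listed exactly once.
subsets : ∀ m → List (Subset m)
subsets zero    = []ᵛ ∷ []
subsets (suc m) = map (outside ∷ᵛ_) (subsets m) ++ map (inside ∷ᵛ_) (subsets m)

module _ (H : Hypergraph) where
  open Hypergraph H

  signedCount : {P : Subset m → Set} → Decidable₁ P → ℤ
  signedCount P? = ∑ (filter P? (subsets m)) (λ F → -1ℤ ^ ∣ F ∣)

  a : ℕ → ℤ
  a i = signedCount (λ F → k F ≟ i)

  𝓑 : Fin m → ℕ → ℕ → Subset m → Set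
  𝓑 e i j F = e ∈ F × k F ≡ i × k (F - e) ≡ j

  𝓑? : ∀ e i j → Decidable₁ (𝓑 e i j)
  𝓑? e i j F = (e ∈? F) ×-dec (k F ≟ i) ×-dec (k (F - e) ≟ j)

  b : Fin m → ℕ → ℕ → ℤ
  b e i j = signedCount (𝓑? e i j)

{-# OPTIONS --safe #-}

-- Pair each F ∌ e with F ∪ {e}.  With p = k(F) and q = k(F ∖ {e}), this gives
--   a_i = Σ_{F ∋ e} (-1)^|F| ([p = i] - [q = i]).
-- Deleting an edge only splits components, so 1 ≤ p ≤ q ≤ n.  Terms with p = q
-- cancel; those with p = i < q are counted by the b_e^{i,j} with j > i, and
-- those with p < i = q by the b_e^{j,i} with j < i.
module Submission where

open import Defs
open import Algebra.Properties.CommutativeSemigroup using (interchange)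
open import Data.Bool using (if_then_else_)
open import Data.Fin using (Fin; zero; suc; fromℕ<)
open import Data.Fin.Properties using (injective⇒≤; nonZeroIndex)
open import Data.Fin.Subset using (Subset; _∈_; _⊆_; ∣_∣; inside; outside) renaming (_-_ to _⊝_)
open import Data.Fin.Subset.Properties using (_∈?_; p─⊥≡p; p─q⊆p)
open import Data.Integer using (ℤ; 0ℤ; -1ℤ; _+_; _-_; -_; _^_)
open import Data.Integer.Properties using (+-assoc; +-comm; +-identityˡ; +-identityʳ; +-inverseʳ;
  +-commutativeSemigroup; neg-distrib-+; neg-involutive; -1*i≡-i)
open import Data.List using (List; []; _∷_; _++_; map; filter)
open import Data.List.Membership.Propositional using (find; lose) renaming (_∈_ to _∈ˡ_)
open import Data.List.Membership.Propositional.Properties using (∈-filter⁺; ∈-filter⁻; ∈-applyUpTo⁺)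
import Data.List.Relation.Unary.All as All
open import Data.List.Relation.Unary.AllPairs using ([]; _∷_)
open import Data.List.Relation.Unary.Any as Any using (Any; any?)
open import Data.List.Relation.Unary.Unique.Propositional using (Unique)
import Data.List.Relation.Unary.Unique.Propositional.Properties as Unique
open import Data.Nat using (ℕ; suc; _≤_; _<_; _<?_; _≟_; s≤s; >-nonZero⁻¹)
open import Data.Nat.Properties using (m≤n⇒m<n∨m≡n; <⇒≢; suc-injective)
open import Data.Product using (_×_; _,_; proj₁; proj₂)
open import Data.Sum using (inj₁; inj₂)
open import Data.Vec using (_∷_; here; there)
open import Function using (_∘_; _⇔_; mk⇔; Inverse)
open import Level using (0ℓ)
open import Relation.Binary using (Rel; _⇒_)
import Relation.Binary.Construct.Closure.Equivalence as Eq
open import Relation.Binary.PropositionalEquality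
  using (_≡_; refl; sym; trans; cong; cong₂; module ≡-Reasoning)
open import Relation.Nullary using (Dec; does; yes; no; ¬_; contradiction; _⊎-dec_; _×-dec_)
open import Relation.Nullary.Decidable using (does-⇔; dec-false)
open import Relation.Unary using (Decidable)

open ≡-Reasoning

-- Indicators and finite sums of integers

private
  variable
    A J P Q : Set

-- Only the boolean `does P?` is inspected, so the value is unaffected by how `P` is proved, and
-- decisions with the same boolean can be exchanged by computation.
when : Dec P → ℤ → ℤ
when P? z = if does P? then z else 0ℤ

when-false : (P? : Dec P) → ¬ P → ∀ z → when P? z ≡ 0ℤ
when-false P? ¬p z = cong (if_then z else 0ℤ) (dec-false P? ¬p)

when-⇔ : P ⇔ Q → (P? : Dec P) (Q? : Dec Q) → ∀ z → when P? z ≡ when Q? z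
when-⇔ P⇔Q P? Q? z = cong (if_then z else 0ℤ) (does-⇔ P⇔Q P? Q?)

when-neg : (P? : Dec P) → ∀ z → when P? (- z) ≡ - when P? z
when-neg (yes _) z = refl
when-neg (no _)  z = refl

when-⊎ : ¬ (P × Q) → (P? : Dec P) (Q? : Dec Q) → ∀ z →
         when P? z + when Q? z ≡ when (P? ⊎-dec Q?) z
when-⊎ ¬pq (yes p) (yes q) z = contradiction (p , q) ¬pq
when-⊎ ¬pq (yes p) (no _)  z = +-identityʳ z
when-⊎ ¬pq (no _)  Q?      z = +-identityˡ _

∑-cong : (xs : List A) {f g : A → ℤ} → (∀ x → f x ≡ g x) → ∑ xs f ≡ ∑ xs g
∑-cong []       f≗g = refl
∑-cong (x ∷ xs) f≗g = cong₂ _+_ (f≗g x) (∑-cong xs f≗g)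

∑-zero : (xs : List A) → ∑ xs (λ _ → 0ℤ) ≡ 0ℤ
∑-zero []       = refl
∑-zero (x ∷ xs) = trans (+-identityˡ _) (∑-zero xs)

∑-+ : (xs : List A) (f g : A → ℤ) → ∑ xs f + ∑ xs g ≡ ∑ xs (λ x → f x + g x)
∑-+ []       f g = refl
∑-+ (x ∷ xs) f g = trans (interchange +-commutativeSemigroup (f x) (∑ xs f) (g x) (∑ xs g))
                         (cong (f x + g x +_) (∑-+ xs f g))

∑-neg : (xs : List A) (f : A → ℤ) → - ∑ xs f ≡ ∑ xs (λ x → - f x)
∑-neg []       f = refl
∑-neg (x ∷ xs) f = trans (neg-distrib-+ (f x) (∑ xs f)) (cong (- f x +_) (∑-neg xs f))

∑-minus : (xs : List A) (f g : A → ℤ) → ∑ xs f - ∑ xs g ≡ ∑ xs (λ x → f x - g x)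
∑-minus xs f g = trans (cong (∑ xs f +_) (∑-neg xs g)) (∑-+ xs f (λ x → - g x))

∑-++ : (xs ys : List A) (f : A → ℤ) → ∑ (xs ++ ys) f ≡ ∑ xs f + ∑ ys f
∑-++ []       ys f = sym (+-identityˡ _)
∑-++ (x ∷ xs) ys f = trans (cong (f x +_) (∑-++ xs ys f)) (sym (+-assoc (f x) _ _))

∑-map : (h : J → A) (xs : List J) (f : A → ℤ) → ∑ (map h xs) f ≡ ∑ xs (f ∘ h)
∑-map h []       f = refl
∑-map h (x ∷ xs) f = cong (f (h x) +_) (∑-map h xs f)

∑-filter : {P : A → Set} (P? : Decidable P) (xs : List A) (f : A → ℤ) →
           ∑ (filter P? xs) f ≡ ∑ xs (λ x → when (P? x) (f x))
∑-filter P? []       f = refl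
∑-filter P? (x ∷ xs) f with P? x
... | yes _ = cong (f x +_) (∑-filter P? xs f)
... | no _  = trans (∑-filter P? xs f) (sym (+-identityˡ _))

-- By `disjoint`, an `x` satisfies `R j` for at most one `j`, and `Unique` ensures that this `j`
-- occurs at most once in the list. Hence no `f x` is added twice, and a sum of indicators is the
-- indicator of the union.
∑-fibres : {R : J → A → Set} (R? : ∀ j → Decidable (R j)) →
           (∀ {i j x} → R i x → R j x → i ≡ j) →
           {js : List J} → Unique js → (xs : List A) (f : A → ℤ) →
           ∑ js (λ j → ∑ (filter (R? j) xs) f) ≡ ∑ xs (λ x → when (any? (λ j → R? j x) js) (f x))
∑-fibres R? disjoint []                     xs f = sym (∑-zero xs)
∑-fibres R? disjoint {j ∷ js} (j∉js ∷ uniq) xs f = begin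
  ∑ (filter (R? j) xs) f + ∑ js (λ i → ∑ (filter (R? i) xs) f)
    ≡⟨ cong₂ _+_ (∑-filter (R? j) xs f) (∑-fibres R? disjoint uniq xs f) ⟩
  ∑ xs (λ x → when (R? j x) (f x)) + ∑ xs (λ x → when (any? (λ i → R? i x) js) (f x))
    ≡⟨ ∑-+ xs _ _ ⟩
  ∑ xs (λ x → when (R? j x) (f x) + when (any? (λ i → R? i x) js) (f x))
    -- On booleans, `any?` over `j ∷ js` computes to the disjunction of its head and tail decisions,
    -- which is the form that `when-⊎` produces.
    ≡⟨ ∑-cong xs (λ x → when-⊎ (separate x) (R? j x) (any? (λ i → R? i x) js) (f x)) ⟩
  ∑ xs (λ x → when (any? (λ i → R? i x) (j ∷ js)) (f x)) ∎
  where
  separate : ∀ x → ¬ (_ × Any _ _)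
  separate x (r , any) with i , i∈js , r′ ← find any = All.lookup j∉js i∈js (disjoint r r′)

-- Sums over subsets, paired by deleting one element

∑-subsets : ∀ m (f : Subset (suc m) → ℤ) →
            ∑ (subsets (suc m)) f ≡ ∑ (subsets m) (f ∘ (outside ∷_)) + ∑ (subsets m) (f ∘ (inside ∷_))
∑-subsets m f = trans (∑-++ (map (outside ∷_) (subsets m)) _ f)
                      (cong₂ _+_ (∑-map _ (subsets m) f) (∑-map _ (subsets m) f))

-- Each subset avoiding `x` is `p ⊝ x` for exactly one `p` containing `x`. For `zero` the two halves
-- of the list `subsets` are matched term by term; for `suc x` the induction hypothesis applies to
-- each half.
∑-pair : ∀ {m} (x : Fin m) (f : Subset m → ℤ) →
         ∑ (subsets m) f ≡ ∑ (subsets m) (λ p → when (x ∈? p) (f p + f (p ⊝ x)))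
∑-pair {suc m} zero f = begin
  ∑ (subsets (suc m)) f
    ≡⟨ ∑-subsets m f ⟩
  ∑ S (f ∘ (outside ∷_)) + ∑ S (f ∘ (inside ∷_))
    ≡⟨ +-comm (∑ S (f ∘ (outside ∷_))) _ ⟩
  ∑ S (f ∘ (inside ∷_)) + ∑ S (f ∘ (outside ∷_))
    ≡⟨ ∑-+ S _ _ ⟩
  ∑ S (λ p → f (inside ∷ p) + f (outside ∷ p))
    -- Deleting `zero` from `inside ∷ p` computes to a set whose tail is `p` minus the empty set,
    -- hence the rewriting by `p─⊥≡p`.
    ≡⟨ ∑-cong S (λ p → cong (λ q → f (inside ∷ p) + f (outside ∷ q)) (p─⊥≡p p)) ⟨
  ∑ S (λ p → g (inside ∷ p))
    -- The sets avoiding `zero` contribute nothing to `g`.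
    ≡⟨ trans (cong (_+ ∑ S (g ∘ (inside ∷_))) (∑-zero S)) (+-identityˡ _) ⟨
  ∑ S (λ p → g (outside ∷ p)) + ∑ S (λ p → g (inside ∷ p))
    ≡⟨ ∑-subsets m g ⟨
  ∑ (subsets (suc m)) g ∎
  where
  S = subsets m
  g = λ p → when (zero ∈? p) (f p + f (p ⊝ zero))
-- Membership of `suc x` and deletion of `suc x` both compute to the same operation on the tail, so
-- the two induction hypotheses fit without rewriting.
∑-pair {suc m} (suc x) f = trans (∑-subsets m f)
  (trans (cong₂ _+_ (∑-pair x (f ∘ (outside ∷_))) (∑-pair x (f ∘ (inside ∷_))))
         (sym (∑-subsets m (λ p → when (suc x ∈? p) (f p + f (p ⊝ suc x))))))

∣p∣≡1+∣p-x∣ : ∀ {m} {x : Fin m} {p} → x ∈ p → ∣ p ∣ ≡ suc ∣ p ⊝ x ∣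
∣p∣≡1+∣p-x∣ {p = _ ∷ p}       here        = cong (suc ∘ ∣_∣) (sym (p─⊥≡p p))
∣p∣≡1+∣p-x∣ {p = inside ∷ _}  (there x∈p) = cong suc (∣p∣≡1+∣p-x∣ x∈p)
∣p∣≡1+∣p-x∣ {p = outside ∷ _} (there x∈p) = ∣p∣≡1+∣p-x∣ x∈p

-- Deletion lowers the cardinality by exactly one. This turns the sum over a pair into a difference
-- of indicators.
sign-delete : ∀ {m} {x : Fin m} {p} → x ∈ p → -1ℤ ^ ∣ p ⊝ x ∣ ≡ - (-1ℤ ^ ∣ p ∣)
sign-delete {x = x} {p} x∈p = begin
  s                 ≡⟨ neg-involutive s ⟨
  - - s             ≡⟨ cong -_ (-1*i≡-i s) ⟨
  - (-1ℤ ^ suc ∣ p ⊝ x ∣) ≡⟨ cong (λ l → - (-1ℤ ^ l)) (∣p∣≡1+∣p-x∣ x∈p) ⟨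
  - (-1ℤ ^ ∣ p ∣)   ∎
  where s = -1ℤ ^ ∣ p ⊝ x ∣

-- Bounds and monotonicity of the number of classes

module _ {n k : ℕ} {R : Rel (Fin n) 0ℓ} (I : HasClasses R k) where
  open Inverse I

  private
    from-reflects : ∀ {c d} → Eq.EqClosure R (from c) (from d) → c ≡ d
    from-reflects p = trans (sym (strictlyInverseˡ _)) (trans (to-cong p) (strictlyInverseˡ _))

  -- Choosing a representative by `from` is injective, because `to` recovers the class.
  classes≤n : k ≤ n
  classes≤n = injective⇒≤ {f = from} λ {c} {d} p →
    trans (sym (strictlyInverseˡ c)) (trans (cong to p) (strictlyInverseˡ d))

  classes-positive : Fin n → 1 ≤ k
  classes-positive x = >-nonZero⁻¹ k {{nonZeroIndex (to x)}}

  -- Each `R`-class is sent to the `R′`-class of its representative. This is injective: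
  -- representatives equivalent under the finer relation are equivalent under `R`, hence represent
  -- the same class.
  classes-antitone : ∀ {l} {R′ : Rel (Fin n) 0ℓ} → HasClasses R′ l → R′ ⇒ R → k ≤ l
  classes-antitone I′ R′⇒R = injective⇒≤ {f = I′.to ∘ from} λ {c} {d} p →
    from-reflects (Eq.map R′⇒R (Eq.transitive _ (Eq.symmetric _ (I′.strictlyInverseʳ (from c)))
      (Eq.transitive _ (I′.from-cong p) (I′.strictlyInverseʳ (from d)))))
    where module I′ = Inverse I′

-- If `p < q`, the added conjunct is true in both terms. If `p ≡ q`, each side subtracts a term from
-- itself.
indicator-difference : ∀ {p q} i → p ≤ q → ∀ z →
  when (p ≟ i) z - when (q ≟ i) z
    ≡ when ((p ≟ i) ×-dec (p <? q)) z - when ((q ≟ i) ×-dec (p <? q)) z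
indicator-difference {p} {q} i p≤q z with m≤n⇒m<n∨m≡n p≤q
... | inj₁ p<q = cong₂ _-_
  (when-⇔ (add p<q) (p ≟ i) ((p ≟ i) ×-dec (p <? q)) z)
  (when-⇔ (add p<q) (q ≟ i) ((q ≟ i) ×-dec (p <? q)) z)
  where
  add : Q → P ⇔ (P × Q)
  add r = mk⇔ (_, r) proj₁
... | inj₂ refl = trans (+-inverseʳ (when (p ≟ i) z))
  (sym (+-inverseʳ (when ((p ≟ i) ×-dec (p <? p)) z)))

∈-[1⋯] : ∀ {j n} → 1 ≤ j → j ≤ n → j ∈ˡ [1⋯ n ]
∈-[1⋯] (s≤s _) j≤n = ∈-applyUpTo⁺ suc j≤n

[1⋯]-unique : ∀ n → Unique [1⋯ n ]
[1⋯]-unique n = Unique.applyUpTo⁺₁ suc n (λ i<j _ → <⇒≢ i<j ∘ suc-injective)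

-- Component counts of spanning subgraphs

module _ (H : Hypergraph) where
  open Hypergraph H

  neighbours-mono : ∀ {F G} → F ⊆ G → Neighbours F ⇒ Neighbours G
  neighbours-mono F⊆G (x≢y , f , f∈F , x∈f , y∈f) = x≢y , f , F⊆G f∈F , x∈f , y∈f

  k-antitone : ∀ {F G} → F ⊆ G → k G ≤ k F
  k-antitone {F} {G} F⊆G =
    classes-antitone (proj₂ (components G)) (proj₂ (components F)) (neighbours-mono F⊆G)

  k-positive : ∀ F → 1 ≤ k F
  -- The vertex set is non-empty, so vertex `0` exists and its class is a component.
  k-positive F = classes-positive (proj₂ (components F)) (fromℕ< (>-nonZero⁻¹ n {{nonEmpty}}))

  k≤n : ∀ F → k F ≤ n
  k≤n F = classes≤n (proj₂ (components F))

  -- Edge sets counted by the two sums of `b`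

  module _ (e : Fin m) (i : ℕ) where
    above below : List ℕ
    above = filter (λ j → i <? j) [1⋯ n ]
    below = filter (λ j → j <? i) [1⋯ n ]

    Above Below : Subset m → Set
    Above F = Any (λ j → 𝓑 H e i j F) above
    Below F = Any (λ j → 𝓑 H e j i F) below

    above? : Decidable Above
    above? F = any? (λ j → 𝓑? H e i j F) above

    below? : Decidable Below
    below? F = any? (λ j → 𝓑? H e j i F) below

    -- The families are disjoint for distinct `j`, since membership forces `j` to be `k (F ⊝ e)`.
    ∑-above : ∑ above (b H e i) ≡ ∑ (subsets m) (λ F → when (above? F) (-1ℤ ^ ∣ F ∣))
    ∑-above = ∑-fibres (𝓑? H e i) (λ { (_ , _ , refl) (_ , _ , q) → q })
      (Unique.filter⁺ (λ j → i <? j) ([1⋯]-unique n)) (subsets m) _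

    -- Here `j` is forced to be `k F`.
    ∑-below : ∑ below (λ j → b H e j i) ≡ ∑ (subsets m) (λ F → when (below? F) (-1ℤ ^ ∣ F ∣))
    ∑-below = ∑-fibres (λ j → 𝓑? H e j i) (λ { (_ , refl , _) (_ , p , _) → p })
      (Unique.filter⁺ (λ j → j <? i) ([1⋯]-unique n)) (subsets m) _

    -- The only possible index is `k (F ⊝ e)`. It lies between `1` and `n`, so its membership in
    -- `above` amounts to the strict inequality.
    above-⇔ : ∀ {F} → e ∈ F → (k F ≡ i × k F < k (F ⊝ e)) ⇔ Above F
    above-⇔ {F} e∈F = mk⇔
      (λ { (refl , p<q) → lose
        (∈-filter⁺ (λ j → i <? j) (∈-[1⋯] (k-positive (F ⊝ e)) (k≤n (F ⊝ e))) p<q)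
        (e∈F , refl , refl) })
      back
      where
      back : Above F → k F ≡ i × k F < k (F ⊝ e)
      back any with _ , j∈ , _ , refl , refl ← find any =
        refl , proj₂ (∈-filter⁻ (λ j → i <? j) {xs = [1⋯ n ]} j∈)

    -- As for `above-⇔`, with `k F` as the only possible index.
    below-⇔ : ∀ {F} → e ∈ F → (k (F ⊝ e) ≡ i × k F < k (F ⊝ e)) ⇔ Below F
    below-⇔ {F} e∈F = mk⇔
      (λ { (refl , p<q) → lose
        (∈-filter⁺ (λ j → j <? i) (∈-[1⋯] (k-positive F) (k≤n F)) p<q)
        (e∈F , refl , refl) })
      back
      where
      back : Below F → k (F ⊝ e) ≡ i × k F < k (F ⊝ e)
      back any with _ , j∈ , _ , refl , refl ← find any =
        refl , proj₂ (∈-filter⁻ (λ j → j <? i) {xs = [1⋯ n ]} j∈)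

    -- The decision is an argument so that matching on it makes the outer `when` compute.
    pair-contribution : ∀ F (e∈?F : Dec (e ∈ F)) →
      when e∈?F (when (k F ≟ i) (-1ℤ ^ ∣ F ∣) + when (k (F ⊝ e) ≟ i) (-1ℤ ^ ∣ F ⊝ e ∣))
        ≡ when (above? F) (-1ℤ ^ ∣ F ∣) - when (below? F) (-1ℤ ^ ∣ F ∣)
    pair-contribution F (yes e∈F) = begin
      when (k F ≟ i) s + when (k (F ⊝ e) ≟ i) (-1ℤ ^ ∣ F ⊝ e ∣)
        ≡⟨ cong (λ t → when (k F ≟ i) s + when (k (F ⊝ e) ≟ i) t) (sign-delete e∈F) ⟩
      when (k F ≟ i) s + when (k (F ⊝ e) ≟ i) (- s)
        ≡⟨ cong (when (k F ≟ i) s +_) (when-neg (k (F ⊝ e) ≟ i) s) ⟩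
      when (k F ≟ i) s - when (k (F ⊝ e) ≟ i) s
        -- Since `F ⊝ e` is contained in `F`, it has at least as many components; the cases of
        -- equality cancel here.
        ≡⟨ indicator-difference i (k-antitone (p─q⊆p F _)) s ⟩
      when p≡i×p<q? s - when q≡i×p<q? s
        ≡⟨ cong₂ _-_ (when-⇔ (above-⇔ e∈F) p≡i×p<q? (above? F) s)
                     (when-⇔ (below-⇔ e∈F) q≡i×p<q? (below? F) s) ⟩
      when (above? F) s - when (below? F) s ∎
      where
      s        = -1ℤ ^ ∣ F ∣
      p≡i×p<q? = (k F ≟ i) ×-dec (k F <? k (F ⊝ e))
      q≡i×p<q? = (k (F ⊝ e) ≟ i) ×-dec (k F <? k (F ⊝ e))
    -- The left side is `0ℤ`. On the right both indicators vanish, because every member of a family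
    -- `𝓑 H e _ _` contains `e`.
    pair-contribution F (no e∉F) = sym (cong₂ _-_
      (when-false (above? F) (e∉F ∘ proj₁ ∘ proj₂ ∘ Any.satisfied) _)
      (when-false (below? F) (e∉F ∘ proj₁ ∘ proj₂ ∘ Any.satisfied) _))

mainTheorem3 : (H : Hypergraph) → let open Hypergraph H in
    (e : Fin m) (i : ℕ) → 1 ≤ i → i ≤ n →
    a H i ≡ ∑ (filter (λ j → i <? j) [1⋯ n ]) (λ j → b H e i j)
    - ∑ (filter (λ j → j <? i) [1⋯ n ]) (λ j → b H e j i)
mainTheorem3 H e i _ _ = begin
  a H i
    ≡⟨ ∑-filter (λ F → k F ≟ i) S _ ⟩
  ∑ S (λ F → when (k F ≟ i) (-1ℤ ^ ∣ F ∣))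
    ≡⟨ ∑-pair e _ ⟩
  ∑ S (λ F → when (e ∈? F) (when (k F ≟ i) (-1ℤ ^ ∣ F ∣) + when (k (F ⊝ e) ≟ i) (-1ℤ ^ ∣ F ⊝ e ∣)))
    ≡⟨ ∑-cong S (λ F → pair-contribution H e i F (e ∈? F)) ⟩
  ∑ S (λ F → when (above? H e i F) (-1ℤ ^ ∣ F ∣) - when (below? H e i F) (-1ℤ ^ ∣ F ∣))
    ≡⟨ ∑-minus S _ _ ⟨
  ∑ S (λ F → when (above? H e i F) (-1ℤ ^ ∣ F ∣)) - ∑ S (λ F → when (below? H e i F) (-1ℤ ^ ∣ F ∣))
    ≡⟨ cong₂ _-_ (∑-above H e i) (∑-below H e i) ⟨
  ∑ (above H e i) (b H e i) - ∑ (below H e i) (λ j → b H e j i) ∎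
  where
  open Hypergraph H
  S = subsets m
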